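{- For every fixed integer $k\ge 1$, there are only finitely many (up to isomorphism) $k$-vertex-critical $(P_5,\text{gem})$-free graphs.
   Context: All graphs are finite and simple. $P_5$ is the path on 5 vertices. The gem is the graph obtained from an induced path $P_4$ by adding one vertex adjacent to all four vertices of the path. A graph $G$ is $H$-free if no induced subgraph of $G$ is isomorphic to $H$, and $(H_1,H_2)$-free if it is both $H_1$-free and $H_2$-free. $\chi(G)$ denotes the chromatic number. A graph $G$ is $k$-vertex-critical if $\chi(G)=k$ and $\chi(G-v)<k$ for every vertex $v\in V(G)$. -}

module Defs where

open import Data.Nat using (ℕ; zero; suc; _≥_; _<_)
open import Data.Fin using (Fin; zero; suc; punchIn)
open import Data.Bool using (Bool; true; false; T)
open import Data.Product using (Σ; ∃; _×_; _,_; proj₁)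
open import Data.List using (List)
open import Data.List.Membership.Propositional using (_∈_)
open import Relation.Binary.PropositionalEquality using (_≡_; refl)
open import Relation.Nullary using (¬_)
open import Function.Definitions using (Injective)

record Graph (n : ℕ) : Set where
  field
    adj   : Fin n → Fin n → Bool
    sym   : ∀ u v → adj u v ≡ adj v u
    irrefl : ∀ v → adj v v ≡ false
open Graph public

record AnyGraph : Set where
  constructor ⟨_,_⟩
  field
    order : ℕ
    graph : Graph order
open AnyGraph public

record _≅_ {m n : ℕ} (G : Graph m) (H : Graph n) : Set where
  field
    to      : Fin m → Fin n
    from    : Fin n → Fin m
    from∘to : ∀ x → from (to x) ≡ x
    to∘from : ∀ y → to (from y) ≡ y
    pres    : ∀ u v → adj H (to u) (to v) ≡ adj G u v

InducedSub : {m n : ℕ} → Graph m → Graph n → Set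
InducedSub {m} {n} H G =
  Σ (Fin m → Fin n) λ f → Injective _≡_ _≡_ f × (∀ u v → adj G (f u) (f v) ≡ adj H u v)

Free : {m n : ℕ} → Graph m → Graph n → Set
Free H G = ¬ InducedSub H G

Colourable : {n : ℕ} → ℕ → Graph n → Set
Colourable {n} k G =
  Σ (Fin n → Fin k) λ c → ∀ u v → T (adj G u v) → ¬ (c u ≡ c v)

ChromaticNumber≡ : {n : ℕ} → Graph n → ℕ → Set
ChromaticNumber≡ G k = Colourable k G × (∀ j → Colourable j G → j ≥ k)

deleteVertex : {m : ℕ} → Graph (suc m) → Fin (suc m) → Graph m
deleteVertex G v = record
  { adj    = λ a b → adj G (punchIn v a) (punchIn v b)
  ; sym    = λ a b → sym G (punchIn v a) (punchIn v b)
  ; irrefl = λ a → irrefl G (punchIn v a)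
  }

ChromaticNumber< : {n : ℕ} → Graph n → ℕ → Set
ChromaticNumber< G k = Σ ℕ λ j → (j < k) × Colourable j G

VertexCritical : {n : ℕ} → ℕ → Graph n → Set
VertexCritical {zero}  k G = ChromaticNumber≡ G k
VertexCritical {suc m} k G =
  ChromaticNumber≡ G k × (∀ v → ChromaticNumber< (deleteVertex G v) k)

pathAdj : Fin 5 → Fin 5 → Bool
pathAdj zero (suc zero) = true
pathAdj (suc zero) zero = true
pathAdj (suc zero) (suc (suc zero)) = true
pathAdj (suc (suc zero)) (suc zero) = true
pathAdj (suc (suc zero)) (suc (suc (suc zero))) = true
pathAdj (suc (suc (suc zero))) (suc (suc zero)) = true
pathAdj (suc (suc (suc zero))) (suc (suc (suc (suc zero)))) = true
pathAdj (suc (suc (suc (suc zero)))) (suc (suc (suc zero))) = true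
pathAdj _ _ = false

-- gem: path 0-1-2-3 plus vertex 4 adjacent to 0,1,2,3.
gemAdj : Fin 5 → Fin 5 → Bool
gemAdj zero (suc zero) = true
gemAdj (suc zero) zero = true
gemAdj (suc zero) (suc (suc zero)) = true
gemAdj (suc (suc zero)) (suc zero) = true
gemAdj (suc (suc zero)) (suc (suc (suc zero))) = true
gemAdj (suc (suc (suc zero))) (suc (suc zero)) = true
gemAdj (suc (suc (suc (suc zero)))) (suc (suc (suc (suc zero)))) = false
gemAdj (suc (suc (suc (suc zero)))) _ = true
gemAdj _ (suc (suc (suc (suc zero)))) = true
gemAdj _ _ = false


pathSym : ∀ u v → pathAdj u v ≡ pathAdj v u
pathSym zero zero = refl
pathSym zero (suc zero) = refl
pathSym zero (suc (suc zero)) = refl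
pathSym zero (suc (suc (suc zero))) = refl
pathSym zero (suc (suc (suc (suc zero)))) = refl
pathSym (suc zero) zero = refl
pathSym (suc zero) (suc zero) = refl
pathSym (suc zero) (suc (suc zero)) = refl
pathSym (suc zero) (suc (suc (suc zero))) = refl
pathSym (suc zero) (suc (suc (suc (suc zero)))) = refl
pathSym (suc (suc zero)) zero = refl
pathSym (suc (suc zero)) (suc zero) = refl
pathSym (suc (suc zero)) (suc (suc zero)) = refl
pathSym (suc (suc zero)) (suc (suc (suc zero))) = refl
pathSym (suc (suc zero)) (suc (suc (suc (suc zero)))) = refl
pathSym (suc (suc (suc zero))) zero = refl
pathSym (suc (suc (suc zero))) (suc zero) = refl
pathSym (suc (suc (suc zero))) (suc (suc zero)) = refl
pathSym (suc (suc (suc zero))) (suc (suc (suc zero))) = refl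
pathSym (suc (suc (suc zero))) (suc (suc (suc (suc zero)))) = refl
pathSym (suc (suc (suc (suc zero)))) zero = refl
pathSym (suc (suc (suc (suc zero)))) (suc zero) = refl
pathSym (suc (suc (suc (suc zero)))) (suc (suc zero)) = refl
pathSym (suc (suc (suc (suc zero)))) (suc (suc (suc zero))) = refl
pathSym (suc (suc (suc (suc zero)))) (suc (suc (suc (suc zero)))) = refl

pathIrr : ∀ v → pathAdj v v ≡ false
pathIrr zero = refl
pathIrr (suc zero) = refl
pathIrr (suc (suc zero)) = refl
pathIrr (suc (suc (suc zero))) = refl
pathIrr (suc (suc (suc (suc zero)))) = refl

gemSym : ∀ u v → gemAdj u v ≡ gemAdj v u
gemSym zero zero = refl
gemSym zero (suc zero) = refl
gemSym zero (suc (suc zero)) = refl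
gemSym zero (suc (suc (suc zero))) = refl
gemSym zero (suc (suc (suc (suc zero)))) = refl
gemSym (suc zero) zero = refl
gemSym (suc zero) (suc zero) = refl
gemSym (suc zero) (suc (suc zero)) = refl
gemSym (suc zero) (suc (suc (suc zero))) = refl
gemSym (suc zero) (suc (suc (suc (suc zero)))) = refl
gemSym (suc (suc zero)) zero = refl
gemSym (suc (suc zero)) (suc zero) = refl
gemSym (suc (suc zero)) (suc (suc zero)) = refl
gemSym (suc (suc zero)) (suc (suc (suc zero))) = refl
gemSym (suc (suc zero)) (suc (suc (suc (suc zero)))) = refl
gemSym (suc (suc (suc zero))) zero = refl
gemSym (suc (suc (suc zero))) (suc zero) = refl
gemSym (suc (suc (suc zero))) (suc (suc zero)) = refl
gemSym (suc (suc (suc zero))) (suc (suc (suc zero))) = refl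
gemSym (suc (suc (suc zero))) (suc (suc (suc (suc zero)))) = refl
gemSym (suc (suc (suc (suc zero)))) zero = refl
gemSym (suc (suc (suc (suc zero)))) (suc zero) = refl
gemSym (suc (suc (suc (suc zero)))) (suc (suc zero)) = refl
gemSym (suc (suc (suc (suc zero)))) (suc (suc (suc zero))) = refl
gemSym (suc (suc (suc (suc zero)))) (suc (suc (suc (suc zero)))) = refl

gemIrr : ∀ v → gemAdj v v ≡ false
gemIrr zero = refl
gemIrr (suc zero) = refl
gemIrr (suc (suc zero)) = refl
gemIrr (suc (suc (suc zero))) = refl
gemIrr (suc (suc (suc (suc zero)))) = refl

P5 : Graph 5
P5 = record { adj = pathAdj ; sym = pathSym ; irrefl = pathIrr }

gem : Graph 5
gem = record { adj = gemAdj ; sym = gemSym ; irrefl = gemIrr }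

FinitelyManyUpToIso : (∀ {n} → Graph n → Set) → Set
FinitelyManyUpToIso P =
  Σ (List AnyGraph) λ L → ∀ {n} (G : Graph n) → P G →
    Σ AnyGraph λ H → H ∈ L × (G ≅ graph H)

{-# OPTIONS --safe #-}

-- By downward induction on |K|, the number of common neighbours of a nonempty clique K is
-- bounded in terms of k.  Fix d ∈ K.  By induction, each component of G[N(K)] has bounded
-- size, as it is P₄-free with bounded degree, so only the number of components matters.
-- List each component as copy₁ i, …, copyₛ i.  Criticality forbids retracting component i
-- onto component j, so for all i ≠ j some label a has a vertex outside N(d) adjacent to
-- copyₐ i but not to copyₐ j (or the two components induce different graphs).  By Ramsey's
-- theorem this happens with one label for all i < j and with one label for all i > j in a
-- large set of components.  If the neighbourhoods outside N(d) at one of these labels are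
-- pairwise incomparable, P₅- and gem-freeness yield a clique of size k + 1; otherwise they
-- form two chains in opposite directions, which is impossible already for three components.
-- Thus degrees are bounded, and a connected P₅-free graph is a ball of radius three.
module Submission where

open import Defs
open import Data.Nat using (ℕ; _≥_)
open import Data.Product using (_×_)

open import Data.Bool using (Bool; true; false; T; not; _∧_; _∨_)
import Data.Bool.Properties as Bool
open import Data.Empty using (⊥; ⊥-elim)
open import Data.Fin using (Fin; zero; suc; toℕ; punchOut; inject≤)
import Data.Fin as Fin
import Data.Fin.Properties as Fin
open import Data.List using (List; []; _∷_; _++_; length; map; filter; lookup; concatMap; allFin; upTo; cartesianProduct; cartesianProductWith)
open import Data.List.Membership.Propositional using (_∈_; find; lose)
open import Data.List.Membership.Propositional.Properties
open import Data.List.Properties using (length-map; length-tabulate; length-++)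
open import Data.List.Relation.Binary.Sublist.Propositional using (_⊆_; []; _∷_; _∷ʳ_; ⊆-trans; minimum)
open import Data.List.Relation.Binary.Sublist.Propositional.Properties using (All-resp-⊆; filter-⊆)
open import Data.List.Relation.Unary.All as All using (All; []; _∷_)
open import Data.List.Relation.Unary.All.Properties using (all-filter; ¬All⇒Any¬)
open import Data.List.Relation.Unary.AllPairs as AllPairs using (AllPairs; []; _∷_)
import Data.List.Relation.Unary.AllPairs.Properties as AllPairs
open import Data.List.Relation.Unary.Any as Any using (Any; here; there; index)
open import Data.List.Relation.Unary.Any.Properties using (lookup-index)
open import Data.List.Relation.Unary.Unique.Propositional using (Unique)
import Data.List.Relation.Unary.Unique.Propositional.Properties as Unique
open import Data.Nat using (zero; suc; _+_; _⊔_; _*_; _≤_; _<_; z≤n; s≤s)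
import Data.Nat.Properties as ℕ
open import Data.Product using (Σ; ∃-syntax; _,_; proj₁; proj₂)
open import Data.Sum using (_⊎_; inj₁; inj₂)
open import Data.Vec as Vec using (Vec; []; _∷_)
import Data.Vec.Properties as Vec
open import Function using (_∘_; flip; id; case_of_)
open import Relation.Binary using (Decidable; tri<; tri≈; tri>)
open import Relation.Binary.PropositionalEquality using (_≡_; _≢_; refl; cong; cong₂; subst; subst₂; trans)
  renaming (sym to ≡-sym)
open import Relation.Nullary using (¬_; Dec; yes; no; contradiction; ⌊_⌋)
open import Relation.Nullary.Decidable using (from-yes; ¬?; _×-dec_; _⊎-dec_; _→-dec_)

private variable
  A B C : Set

-- Lists and Ramsey's theorem

AllPairs-resp-⊆ : {R : A → A → Set} {xs ys : List A} → xs ⊆ ys → AllPairs R ys → AllPairs R xs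
AllPairs-resp-⊆ []         _        = []
AllPairs-resp-⊆ (_ ∷ʳ p)   (_ ∷ rs) = AllPairs-resp-⊆ p rs
AllPairs-resp-⊆ (refl ∷ p) (r ∷ rs) = All-resp-⊆ p r ∷ AllPairs-resp-⊆ p rs

AllPairs-lookup : {R : A → A → Set} {xs : List A} → AllPairs R xs →
                  ∀ {i j} → i Fin.< j → R (lookup xs i) (lookup xs j)
AllPairs-lookup (r ∷ _)  {zero}  {suc j} _         = All.lookup r (∈-lookup j)
AllPairs-lookup (_ ∷ rs) {suc i} {suc j} (s≤s i<j) = AllPairs-lookup rs i<j

unique-length≤ : {xs ys : List A} → Unique xs → All (_∈ ys) xs → length xs ≤ length ys
unique-length≤ {xs = xs} {ys} unique xs⊆ys with length xs ℕ.≤? length ys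
... | yes le  = le
... | no  nle with i , j , i<j , same ← Fin.pigeonhole (ℕ.≰⇒> nle) (λ i → index (All.lookup xs⊆ys (∈-lookup i))) =
  contradiction
    (trans (lookup-index (∈ys i)) (trans (cong (lookup ys) same) (≡-sym (lookup-index (∈ys j)))))
    (AllPairs-lookup unique i<j)
  where
  ∈ys : ∀ i → lookup xs i ∈ ys
  ∈ys i = All.lookup xs⊆ys (∈-lookup i)

length-concatMap≤ : (f : A → List B) (m : ℕ) (xs : List A) →
                    All (λ x → length (f x) ≤ m) xs → length (concatMap f xs) ≤ length xs * m
length-concatMap≤ f m []       []         = z≤n
length-concatMap≤ f m (x ∷ xs) (fx≤ ∷ fxs≤) = ℕ.≤-trans
  (ℕ.≤-reflexive (length-++ (f x)))
  (ℕ.+-mono-≤ fx≤ (length-concatMap≤ f m xs fxs≤))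

length-filter-split : {P : A → Set} (P? : ∀ x → Dec (P x)) (xs : List A) →
                      length xs ≤ length (filter P? xs) + length (filter (¬? ∘ P?) xs)
length-filter-split P? [] = z≤n
length-filter-split P? (x ∷ xs) with P? x
... | yes _ = s≤s (length-filter-split P? xs)
... | no  _ = ℕ.≤-trans (s≤s (length-filter-split P? xs)) (ℕ.≤-reflexive (≡-sym (ℕ.+-suc _ _)))

-- Positions out of range return the default, so lists of different lengths can share one set of
-- labels.
nth : A → List A → ℕ → A
nth d []       _       = d
nth d (x ∷ xs) zero    = x
nth d (x ∷ xs) (suc i) = nth d xs i

nth-All : {P : A → Set} {d : A} {xs : List A} → P d → All P xs → ∀ i → P (nth d xs i)
nth-All pd []       i       = pd
nth-All pd (p ∷ _)  zero    = p
nth-All pd (_ ∷ ps) (suc i) = nth-All pd ps i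

nth-∈ : {d x : A} {xs : List A} → x ∈ xs → ∃[ i ] i < length xs × nth d xs i ≡ x
nth-∈ (here refl) = zero , s≤s z≤n , refl
nth-∈ (there x∈)  with i , i< , eq ← nth-∈ x∈ = suc i , s≤s i< , eq

-- Sublists keep the order: the relations used later need not be symmetric, and `R` is asked only of
-- an earlier entry against a later one.
Homogeneous : (A → A → Set) → ℕ → List A → Set
Homogeneous R m xs = ∃[ ys ] ys ⊆ xs × length ys ≡ m × AllPairs R ys

homogeneous-⊆ : {R : A → A → Set} {m : ℕ} {xs ys : List A} →
                xs ⊆ ys → Homogeneous R m xs → Homogeneous R m ys
homogeneous-⊆ xs⊆ys (zs , zs⊆xs , rest) = zs , ⊆-trans zs⊆xs xs⊆ys , rest

homogeneous-∷ : {R : A → A → Set} (R? : Decidable R) {m : ℕ} {x : A} {xs : List A} →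
                Homogeneous R m (filter (R? x) xs) → Homogeneous R (suc m) (x ∷ xs)
homogeneous-∷ R? {x = x} {xs} (ys , ys⊆ , len , rs) =
  x ∷ ys , refl ∷ ⊆-trans ys⊆ (filter-⊆ (R? x) xs) , cong suc len ,
  All-resp-⊆ ys⊆ (all-filter (R? x) xs) ∷ rs

ramseyBound : ℕ → ℕ → ℕ
ramseyBound zero    _       = 0
ramseyBound (suc s) zero    = 0
ramseyBound (suc s) (suc t) = suc (ramseyBound s (suc t) + ramseyBound (suc s) t)

ramsey : {R : A → A → Set} (R? : Decidable R) (s t : ℕ) (xs : List A) → ramseyBound s t ≤ length xs →
         Homogeneous R s xs ⊎ Homogeneous (λ x y → ¬ R x y) t xs
ramsey R? zero    t    xs _ = inj₁ ([] , minimum xs , refl , [])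
ramsey R? (suc s) zero xs _ = inj₂ ([] , minimum xs , refl , [])
ramsey R? (suc s) (suc t) (x ∷ xs) (s≤s large)
  with ramseyBound s (suc t) ℕ.≤? length (filter (R? x) xs)
... | yes manyR with ramsey R? s (suc t) (filter (R? x) xs) manyR
...   | inj₁ h = inj₁ (homogeneous-∷ R? h)
...   | inj₂ h = inj₂ (homogeneous-⊆ (x ∷ʳ filter-⊆ (R? x) xs) h)
ramsey R? (suc s) (suc t) (x ∷ xs) (s≤s large) | no fewR
  with ramsey R? (suc s) t (filter (¬R? x) xs) many¬R
  where
  ¬R? = λ x y → ¬? (R? x y)
  many¬R : ramseyBound (suc s) t ≤ length (filter (¬R? x) xs)
  many¬R = ℕ.+-cancelˡ-≤ (length (filter (R? x) xs)) _ _ (ℕ.≤-trans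
    (ℕ.+-monoˡ-≤ _ (ℕ.<⇒≤ (ℕ.≰⇒> fewR)))
    (ℕ.≤-trans large (length-filter-split (R? x) xs)))
... | inj₁ h = inj₁ (homogeneous-⊆ (x ∷ʳ filter-⊆ (λ y → ¬? (R? x y)) xs) h)
... | inj₂ h = inj₂ (homogeneous-∷ (λ x y → ¬? (R? x y)) h)

manyRamseyBound : ℕ → ℕ → ℕ
-- With no colours left, two entries suffice for a contradiction, as their pair has no colour.
manyRamseyBound zero    m = 2
manyRamseyBound (suc c) m = ramseyBound m (manyRamseyBound c m)

-- Colours may overlap. `ramsey` for the first colour gives a homogeneous list or a list on which
-- that colour never occurs, so one colour fewer remains.
manyRamsey : {R : C → A → A → Set} (R? : ∀ c → Decidable (R c)) (m : ℕ) (cs : List C) (xs : List A) →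
             manyRamseyBound (length cs) m ≤ length xs →
             AllPairs (λ x y → Any (λ c → R c x y) cs) xs → ∃[ c ] Homogeneous (R c) m xs
manyRamsey R? m []       (_ ∷ [])    (s≤s ()) _
manyRamsey R? m []       (_ ∷ _ ∷ _) _        ((() ∷ _) ∷ _)
manyRamsey R? m (c ∷ cs) xs large coloured with ramsey (R? c) m (manyRamseyBound (length cs) m) xs large
... | inj₁ h = c , h
... | inj₂ (ys , ys⊆xs , len , ¬cs) with
  manyRamsey R? m cs ys (ℕ.≤-reflexive (≡-sym len))
    (AllPairs.zipWith (λ { (¬c , here r) → contradiction r ¬c ; (_ , there r) → r })
                      (¬cs , AllPairs-resp-⊆ ys⊆xs coloured))
...   | c′ , h = c′ , homogeneous-⊆ ys⊆xs h

-- Induced subgraphs and critical graphs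

module Adjacency {n : ℕ} (G : Graph n) where

  infix 4 _~_ _≁_

  _~_ _≁_ : Fin n → Fin n → Set
  u ~ v = adj G u v ≡ true
  u ≁ v = adj G u v ≡ false

  ~-sym : ∀ {u v} → u ~ v → v ~ u
  ~-sym {u} {v} u~v = trans (sym G v u) u~v

  ≁-sym : ∀ {u v} → u ≁ v → v ≁ u
  ≁-sym {u} {v} u≁v = trans (sym G v u) u≁v

  ~⇒¬≁ : ∀ {u v} → u ~ v → ¬ u ≁ v
  ~⇒¬≁ u~v u≁v = case trans (≡-sym u~v) u≁v of λ ()

  _~?_ : ∀ u v → Dec (u ~ v)
  u ~? v = adj G u v Bool.≟ true

  _≁?_ : ∀ u v → Dec (u ≁ v)
  u ≁? v = adj G u v Bool.≟ false

  ¬~⇒≁ : ∀ {u v} → ¬ u ~ v → u ≁ v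
  ¬~⇒≁ = Bool.¬-not

  ¬≁⇒~ : ∀ {u v} → ¬ u ≁ v → u ~ v
  ¬≁⇒~ = Bool.¬-not

  ~⇒T : ∀ {u v} → u ~ v → T (adj G u v)
  ~⇒T u~v = subst T (≡-sym u~v) _

  T⇒~ : ∀ {u v} → T (adj G u v) → u ~ v
  T⇒~ {u} {v} t with adj G u v
  ... | true = refl

-- Decided by computation for `P5` and `gem`; it spares every later use of a forbidden subgraph a
-- proof that its vertices are distinct.
TwinFree : {m : ℕ} → Graph m → Set
TwinFree H = ∀ u v → (∀ w → adj H u w ≡ adj H v w) → u ≡ v

twinFree? : {m : ℕ} (H : Graph m) → Dec (TwinFree H)
twinFree? H = Fin.all? λ u → Fin.all? λ v →
  Fin.all? (λ w → adj H u w Bool.≟ adj H v w) →-dec (u Fin.≟ v)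

-- A map that preserves adjacency and non-adjacency only identifies twins.
induced : {m n : ℕ} (H : Graph m) (G : Graph n) → TwinFree H → (f : Fin m → Fin n) →
          (∀ u v → u Fin.< v → adj G (f u) (f v) ≡ adj H u v) → InducedSub H G
induced H G twinFree f ordered = f , injective , preserves
  where
  preserves : ∀ u v → adj G (f u) (f v) ≡ adj H u v
  preserves u v with Fin.<-cmp u v
  ... | tri< u<v _ _  = ordered u v u<v
  ... | tri≈ _ refl _ = trans (irrefl G (f u)) (≡-sym (irrefl H u))
  ... | tri> _ _ v<u  = trans (sym G (f u) (f v)) (trans (ordered v u v<u) (sym H v u))
  injective : ∀ {u v} → f u ≡ f v → u ≡ v
  injective {u} {v} eq = twinFree u v λ w →
    trans (≡-sym (preserves u w)) (trans (cong (λ x → adj G x (f w)) eq) (preserves v w))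

pattern 1F = suc zero
pattern 2F = suc (suc zero)
pattern 3F = suc (suc (suc zero))
pattern 4F = suc (suc (suc (suc zero)))

induced₅ : {n : ℕ} (H : Graph 5) (G : Graph n) → TwinFree H → ∀ {a b c d e} →
           adj G a b ≡ adj H zero 1F → adj G a c ≡ adj H zero 2F →
           adj G a d ≡ adj H zero 3F → adj G a e ≡ adj H zero 4F →
           adj G b c ≡ adj H 1F 2F → adj G b d ≡ adj H 1F 3F → adj G b e ≡ adj H 1F 4F →
           adj G c d ≡ adj H 2F 3F → adj G c e ≡ adj H 2F 4F → adj G d e ≡ adj H 3F 4F →
           InducedSub H G
induced₅ H G twinFree {a} {b} {c} {d} {e} ab ac ad ae bc bd be cd ce de =
  induced H G twinFree (Vec.lookup (a ∷ b ∷ c ∷ d ∷ e ∷ [])) λ where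
    zero 1F _ → ab
    zero 2F _ → ac
    zero 3F _ → ad
    zero 4F _ → ae
    1F   2F _ → bc
    1F   3F _ → bd
    1F   4F _ → be
    2F   3F _ → cd
    2F   4F _ → ce
    3F   4F _ → de
    1F   1F (s≤s ())
    2F   1F (s≤s ())
    2F   2F (s≤s (s≤s ()))
    3F   1F (s≤s ())
    3F   2F (s≤s (s≤s ()))
    3F   3F (s≤s (s≤s (s≤s ())))
    4F   1F (s≤s ())
    4F   2F (s≤s (s≤s ()))
    4F   3F (s≤s (s≤s (s≤s ())))
    4F   4F (s≤s (s≤s (s≤s (s≤s ()))))

module Forbidden {n : ℕ} (G : Graph n) (P5-free : Free P5 G) (gem-free : Free gem G) where

  open Adjacency G

  no-P5 : ∀ {a b c d e} → a ~ b → b ~ c → c ~ d → d ~ e →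
          a ≁ c → a ≁ d → a ≁ e → b ≁ d → b ≁ e → c ≁ e → ⊥
  no-P5 ab bc cd de ac ad ae bd be ce =
    P5-free (induced₅ P5 G (from-yes (twinFree? P5)) ab ac ad ae bc bd be cd ce de)

  no-gem : ∀ {a b c d e} → a ~ b → b ~ c → c ~ d → a ≁ c → a ≁ d → b ≁ d →
           a ~ e → b ~ e → c ~ e → d ~ e → ⊥
  no-gem ab bc cd ac ad bd ae be ce de =
    gem-free (induced₅ gem G (from-yes (twinFree? gem)) ab ac ad ae bc bd be cd ce de)

-- Colourings of the graph without `x` are functions of `u` and a proof of `x ≢ u`, which keeps
-- `punchIn` and the split on the order out of later arguments.
record Critical {n : ℕ} (k : ℕ) (G : Graph n) : Set where
  open Adjacency G
  field
    colourable    : Colourable k G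
    uncolourable  : ∀ {j} → j < k → ¬ Colourable j G
    colour-except : ∀ x → ∃[ j ] j < k × Σ ((u : Fin n) → x ≢ u → Fin j) λ c →
                    ∀ u v x≢u x≢v → u ~ v → c u x≢u ≢ c v x≢v

critical : {n k : ℕ} {G : Graph n} → VertexCritical k G → Critical k G
critical {zero} (colouring , least) = record
  { colourable    = colouring
  ; uncolourable  = λ j<k c → ℕ.<⇒≱ j<k (least _ c)
  ; colour-except = λ ()
  }
critical {suc n} {k} {G} ((colouring , least) , smaller) = record
  { colourable    = colouring
  ; uncolourable  = λ j<k c → ℕ.<⇒≱ j<k (least _ c)
  ; colour-except = except
  }
  where
  open Adjacency G
  except : ∀ x → ∃[ j ] j < k × Σ ((u : Fin (suc n)) → x ≢ u → Fin j) λ c →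
           ∀ u v x≢u x≢v → u ~ v → c u x≢u ≢ c v x≢v
  except x with j , j<k , c , proper ← smaller x =
    j , j<k , (λ u x≢u → c (punchOut x≢u)) , λ u v x≢u x≢v u~v → proper _ _
      (subst₂ (λ a b → T (adj G a b)) (≡-sym (Fin.punchIn-punchOut x≢u)) (≡-sym (Fin.punchIn-punchOut x≢v)) (~⇒T u~v))

module CriticalProperties {n k : ℕ} {G : Graph n} (crit : Critical k G) where

  open Adjacency G
  open Critical crit

  -- Composing `f` with a colouring of the graph without `x` would colour the whole graph with fewer
  -- than `k` colours.
  no-retraction : (f : Fin n → Fin n) → (∀ {u v} → u ~ v → f u ~ f v) →
                  (x : Fin n) → ¬ (∀ u → x ≢ f u)
  no-retraction f hom x missed with j , j<k , c , proper ← colour-except x =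
    uncolourable j<k
      ((λ u → c (f u) (missed u)) , λ u v t → proper _ _ (missed u) (missed v) (hom (T⇒~ t)))

  clique-length≤ : {us : List (Fin n)} → AllPairs _~_ us → length us ≤ k
  clique-length≤ {us} clique with c , proper ← colourable =
    subst₂ _≤_ (length-map c us) (length-tabulate id)
      (unique-length≤ {ys = allFin k}
        (AllPairs.map⁺ (AllPairs.map (λ u~v → proper _ _ (~⇒T u~v)) clique))
        (All.tabulate (λ {i} _ → ∈-allFin i)))

  -- A critical graph is connected: colour R and its complement separately.
  closed⇒full : {R : Fin n → Set} → (∀ u → Dec (R u)) → (∀ {u v} → R u → u ~ v → R v) →
                ∀ {r} → R r → ∀ u → R u
  closed⇒full {R} R? closed {r} Rr x with R? x
  ... | yes Rx = Rx
  ... | no ¬Rx with i , i<k , c , proper ← colour-except x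
                  | j , j<k , c′ , proper′ ← colour-except r =
    ⊥-elim (uncolourable {i ⊔ j} (ℕ.⊔-lub i<k j<k) (colour , proper-colour))
    where
    -- `R` avoids `x` and its complement avoids `r`, so both restricted colourings are defined.
    x≢ : ∀ {u} → R u → x ≢ u
    x≢ Ru refl = ¬Rx Ru
    r≢ : ∀ {u} → ¬ R u → r ≢ u
    r≢ ¬Ru refl = ¬Ru Rr
    colour : Fin n → Fin (i ⊔ j)
    colour u with R? u
    ... | yes Ru = inject≤ (c u (x≢ Ru)) (ℕ.m≤m⊔n i j)
    ... | no ¬Ru = inject≤ (c′ u (r≢ ¬Ru)) (ℕ.m≤n⊔m i j)
    proper-colour : ∀ u v → T (adj G u v) → colour u ≢ colour v
    proper-colour u v t same with R? u | R? v
    ... | yes Ru | yes Rv = proper u v _ _ (T⇒~ t) (Fin.inject≤-injective _ _ _ _ same)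
    ... | yes Ru | no ¬Rv = ¬Rv (closed Ru (T⇒~ t))
    ... | no ¬Ru | yes Rv = ¬Ru (closed Rv (~-sym (T⇒~ t)))
    ... | no ¬Ru | no ¬Rv = proper′ u v _ _ (T⇒~ t) (Fin.inject≤-injective _ _ _ _ same)

-- The neighbourhood of a vertex

module Neighbourhood {n : ℕ} (G : Graph n) (P5-free : Free P5 G) (gem-free : Free gem G) (d : Fin n) where

  open Adjacency G
  open Forbidden G P5-free gem-free

  -- Otherwise `y`, `u`, `d`, `v`, `z` is an induced path.
  separators-adjacent : ∀ {u v y z} → u ~ d → v ~ d → y ≁ d → z ≁ d → u ≁ v →
                        u ~ y → v ~ z → u ≁ z → v ≁ y → y ~ z
  separators-adjacent u~d v~d y≁d z≁d u≁v u~y v~z u≁z v≁y = ¬≁⇒~ λ y≁z →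
    no-P5 (~-sym u~y) u~d (~-sym v~d) v~z y≁d (≁-sym v≁y) y≁z u≁v u≁z (≁-sym z≁d)

  -- Otherwise `u`, `d`, `v`, `y`, `z` is an induced path.
  missed-nonadjacent : ∀ {u v y z} → u ~ d → v ~ d → y ≁ d → z ≁ d → u ≁ v →
                       u ≁ y → u ≁ z → v ~ y → v ≁ z → y ≁ z
  missed-nonadjacent u~d v~d y≁d z≁d u≁v u≁y u≁z v~y v≁z = ¬~⇒≁ λ y~z →
    no-P5 u~d (~-sym v~d) v~y y~z u≁v u≁y u≁z (≁-sym y≁d) (≁-sym z≁d) v≁z

  -- Otherwise the path `d`, `u`, `z`, `y` and the vertex `v` form a gem.
  edge-unmixed : ∀ {u v y z} → u ~ d → v ~ d → y ≁ d → z ≁ d → u ~ v → y ~ z →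
                 u ~ z → v ~ z → v ~ y → u ~ y
  edge-unmixed u~d v~d y≁d z≁d u~v y~z u~z v~z v~y = ¬≁⇒~ λ u≁y →
    no-gem (~-sym u~d) u~z (~-sym y~z) (≁-sym z≁d) (≁-sym y≁d) u≁y (~-sym v~d) u~v (~-sym v~z) (~-sym v~y)

  -- The path is `u′`, `u`, `z`, `v`, `v′`. Applied to edges from two different components, neither
  -- of which `z` sees entirely.
  one-mixed-edge : ∀ {u u′ v v′ z} → u ~ u′ → v ~ v′ → u ≁ v → u ≁ v′ → u′ ≁ v → u′ ≁ v′ →
                   u ~ z → v ~ z → u′ ≁ z → v′ ≁ z → ⊥
  one-mixed-edge u~u′ v~v′ u≁v u≁v′ u′≁v u′≁v′ u~z v~z u′≁z v′≁z =
    no-P5 (~-sym u~u′) u~z (~-sym v~z) v~v′ u′≁z u′≁v u′≁v′ u≁v u≁v′ (≁-sym v′≁z)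

  no-zigzag : ∀ {u v w y z} → u ≁ v → u ≁ w → v ≁ w → u ~ y → v ~ y → v ~ z → w ~ z →
              y ≁ z → u ≁ z → w ≁ y → ⊥
  no-zigzag u≁v u≁w v≁w u~y v~y v~z w~z y≁z u≁z w≁y =
    no-P5 u~y (~-sym v~y) v~z (~-sym w~z) u≁v u≁z u≁w y≁z (≁-sym w≁y) v≁w

  -- Neighbourhoods are compared only outside N(`d`); the negation of `Private u v` is inclusion of
  -- that of `u` in that of `v`.
  Private : Fin n → Fin n → Set
  Private u v = ∃[ z ] z ≁ d × u ~ z × v ≁ z

  Private? : Decidable Private
  Private? u v = Fin.any? λ z → (z ≁? d) ×-dec (u ~? z) ×-dec (v ≁? z)

  ¬Private⇒⊆ : ∀ {u v z} → ¬ Private u v → z ≁ d → u ~ z → v ~ z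
  ¬Private⇒⊆ none z≁d u~z = ¬≁⇒~ λ v≁z → none (_ , z≁d , u~z , v≁z)

  ¬Private⇒⊇ : ∀ {u v z} → ¬ Private u v → z ≁ d → v ≁ z → u ≁ z
  ¬Private⇒⊇ none z≁d v≁z = ¬~⇒≁ λ u~z → none (_ , z≁d , u~z , v≁z)

  Incomparable : Fin n → Fin n → Set
  Incomparable u v = u ~ d × v ~ d × u ≁ v × Private u v × Private v u

  -- If `w` missed `z` too, the witnesses `x`, `y`, `p` of incomparability would give a gem: the
  -- path `v`, `x`, `y`, `w` with centre `p`. Hence a vertex outside N(`d`) that sees a member of an
  -- antichain misses at most one member.
  incomparable-co-matching : ∀ {u v w z} → Incomparable u v → Incomparable v w → u ≁ w → z ≁ d →
                             u ~ z → v ≁ z → w ~ z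
  incomparable-co-matching {u} {v} {w} {z}
    (u~d , _ , u≁v , _ , p , p≁d , v~p , u≁p)
    (v~d , w~d , v≁w , (x , x≁d , v~x , w≁x) , (y , y≁d , w~y , v≁y))
    u≁w z≁d u~z v≁z = ¬≁⇒~ contra
    where
    contra : ¬ w ≁ z
    contra w≁z = no-gem v~x x~y (~-sym w~y) v≁y v≁w (≁-sym w≁x) v~p x~p y~p w~p
      where
      y≁z : y ≁ z
      y≁z = missed-nonadjacent v~d w~d y≁d z≁d v≁w v≁y v≁z w~y w≁z
      x≁z : x ≁ z
      x≁z = missed-nonadjacent w~d v~d x≁d z≁d (≁-sym v≁w) w≁x w≁z v~x v≁z
      z~p : z ~ p
      z~p = separators-adjacent u~d v~d z≁d p≁d u≁v u~z v~p u≁p v≁z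
      x~y : x ~ y
      x~y = separators-adjacent v~d w~d x≁d y≁d v≁w v~x w~y v≁y w≁x
      w~p : w ~ p
      w~p = ¬≁⇒~ λ w≁p → ~⇒¬≁ z~p
        (missed-nonadjacent w~d u~d z≁d p≁d (≁-sym u≁w) w≁z w≁p u~z u≁p)
      u~x : u ~ x
      u~x = ¬≁⇒~ λ u≁x → ~⇒¬≁
        (separators-adjacent u~d v~d z≁d x≁d u≁v u~z v~x u≁x v≁z) (≁-sym x≁z)
      u~y : u ~ y
      u~y = ¬≁⇒~ λ u≁y → ~⇒¬≁
        (separators-adjacent u~d w~d z≁d y≁d u≁w u~z w~y u≁y w≁z) (≁-sym y≁z)
      y~p : y ~ p
      y~p = separators-adjacent u~d v~d y≁d p≁d u≁v u~y v~p u≁p v≁y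
      x~p : x ~ p
      x~p = ¬≁⇒~ λ x≁p → no-zigzag u≁v u≁w v≁w u~x v~x v~p w~p x≁p u≁p w≁x

  -- Choosing z ∈ N(u) ∖ N(v) for each other v, the chosen vertices form a clique.
  antichain⇒clique : ∀ {u vs} → AllPairs Incomparable (u ∷ vs) →
                     ∃[ zs ] length zs ≡ length vs × AllPairs _~_ zs
  antichain⇒clique {u} (above ∷ antichain) =
    let zs , len , clique , _ = choose above antichain in zs , len , clique
    where
    Chosen : Fin n → Fin n → Set
    Chosen v z = z ≁ d × u ~ z × v ≁ z

    -- The last component carries the induction: a vertex chosen for an earlier `v` sees all
    -- vertices chosen for the list.
    choose : ∀ {vs} → All (Incomparable u) vs → AllPairs Incomparable vs →
             ∃[ zs ] length zs ≡ length vs × AllPairs _~_ zs ×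
             (∀ {v y} → Incomparable u v → All (Incomparable v) vs → Chosen v y → All (y ~_) zs)
    choose [] [] = [] , refl , [] , λ _ _ _ → []
    choose (u∥w@(_ , w~d , u≁w , (z , z≁d , u~z , w≁z) , _) ∷ above′) (w∥vs ∷ antichain′)
      with zs , len , clique , extend ← choose above′ antichain′ =
      z ∷ zs , cong suc len , extend u∥w w∥vs (z≁d , u~z , w≁z) ∷ clique , extend′
      where
      extend′ : ∀ {v y} → Incomparable u v → All (Incomparable v) (_ ∷ _) → Chosen v y → All (y ~_) (z ∷ zs)
      extend′ {v} {y} u∥v@(_ , v~d , u≁v , _) (v∥w@(_ , _ , v≁w , vw , wv) ∷ v∥vs) (y≁d , u~y , v≁y) =
        -- Of `v` and the head of the list, `y` misses only `v` and `z` misses only the head.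
        ~-sym (separators-adjacent v~d w~d z≁d y≁d v≁w v~z w~y v≁y w≁z) ∷
        extend u∥v v∥vs (y≁d , u~y , v≁y)
        where
        w~y : _ ~ y
        w~y = incomparable-co-matching u∥v v∥w u≁w y≁d u~y v≁y
        v~z : v ~ z
        v~z = incomparable-co-matching u∥w (w~d , v~d , ≁-sym v≁w , wv , vw) u≁v z≁d u~z w≁z

-- Components of the common neighbourhood of a clique

module Components {n : ℕ} (G : Graph n) (P5-free : Free P5 G) (gem-free : Free gem G)
                  (d : Fin n) (K : List (Fin n)) (clique : AllPairs (Adjacency._~_ G) (d ∷ K)) where

  open Adjacency G
  open Forbidden G P5-free gem-free
  open Neighbourhood G P5-free gem-free d

  CommonNeighbour : Fin n → Set
  CommonNeighbour v = All (v ~_) (d ∷ K)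

  commonNeighbour? : ∀ v → Dec (CommonNeighbour v)
  commonNeighbour? v = All.all? (v ~?_) (d ∷ K)

  Close : Fin n → Fin n → Set
  Close x y = x ≡ y ⊎ x ~ y ⊎ ∃[ p ] CommonNeighbour p × x ~ p × p ~ y

  -- The common neighbours of d ∷ K induce a P₄-free graph, so two of them lie in
  -- the same component exactly when their distance is at most two.
  SameComponent : Fin n → Fin n → Set
  SameComponent x y = CommonNeighbour x × CommonNeighbour y × Close x y

  sameComponent? : Decidable SameComponent
  sameComponent? x y = commonNeighbour? x ×-dec commonNeighbour? y ×-dec
    ((x Fin.≟ y) ⊎-dec (x ~? y) ⊎-dec
     Fin.any? λ p → commonNeighbour? p ×-dec (x ~? p) ×-dec (p ~? y))

  same-refl : ∀ {x} → CommonNeighbour x → SameComponent x x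
  same-refl Nx = Nx , Nx , inj₁ refl

  adjacent⇒same : ∀ {x y} → CommonNeighbour x → CommonNeighbour y → x ~ y → SameComponent x y
  adjacent⇒same Nx Ny x~y = Nx , Ny , inj₂ (inj₁ x~y)

  same-sym : ∀ {x y} → SameComponent x y → SameComponent y x
  same-sym (Nx , Ny , inj₁ refl)                        = Ny , Nx , inj₁ refl
  same-sym (Nx , Ny , inj₂ (inj₁ x~y))                  = Ny , Nx , inj₂ (inj₁ (~-sym x~y))
  same-sym (Nx , Ny , inj₂ (inj₂ (p , Np , x~p , p~y))) = Ny , Nx , inj₂ (inj₂ (p , Np , ~-sym p~y , ~-sym x~p))

  -- Without a shortcut, the walk `x`, `p`, `y`, `w` is an induced path on four vertices, and `d`
  -- completes it to a gem.
  same-step : ∀ {x y w} → SameComponent x y → CommonNeighbour w → y ~ w → SameComponent x w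
  same-step (Nx , Ny , inj₁ refl) Nw y~w = adjacent⇒same Nx Nw y~w
  same-step (Nx , Ny , inj₂ (inj₁ x~y)) Nw y~w = Nx , Nw , inj₂ (inj₂ (_ , Ny , x~y , y~w))
  same-step {x} {y} {w} (Nx , Ny , inj₂ (inj₂ (p , Np , x~p , p~y))) Nw y~w
    with x ~? y | x ~? w | p ~? w
  ... | yes x~y | _       | _       = Nx , Nw , inj₂ (inj₂ (y , Ny , x~y , y~w))
  ... | no _    | yes x~w | _       = adjacent⇒same Nx Nw x~w
  ... | no _    | no _    | yes p~w = Nx , Nw , inj₂ (inj₂ (p , Np , x~p , p~w))
  ... | no x≁y  | no x≁w  | no p≁w  = ⊥-elim
    (no-gem x~p p~y y~w (¬~⇒≁ x≁y) (¬~⇒≁ x≁w) (¬~⇒≁ p≁w)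
      (All.head Nx) (All.head Np) (All.head Ny) (All.head Nw))

  same-trans : ∀ {x y w} → SameComponent x y → SameComponent y w → SameComponent x w
  same-trans xy (_ , _  , inj₁ refl)                        = xy
  same-trans xy (_ , Nw , inj₂ (inj₁ y~w))                  = same-step xy Nw y~w
  same-trans xy (_ , Nw , inj₂ (inj₂ (p , Np , y~p , p~w))) = same-step (same-step xy Np y~p) Nw p~w

  different⇒≁ : ∀ {x y} → CommonNeighbour x → CommonNeighbour y → ¬ SameComponent x y → x ≁ y
  different⇒≁ Nx Ny ¬xy = ¬~⇒≁ (¬xy ∘ adjacent⇒same Nx Ny)

  -- `z` misses some `e` of the clique. If `e` is not `d` and `z` saw `d`, the path `z`, `u`, `e`,
  -- `v` with centre `d` would be a gem. So outside neighbours that separate copies lie outside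
  -- N(`d`).
  separator-≁d : ∀ {u v z} → CommonNeighbour u → CommonNeighbour v → u ≁ v →
                 u ~ z → v ≁ z → ¬ CommonNeighbour z → z ≁ d
  separator-≁d {u} {v} {z} Nu Nv u≁v u~z v≁z ¬Nz with find (¬All⇒Any¬ (z ~?_) (d ∷ K) ¬Nz)
  ... | _ , here refl , z≁d = ¬~⇒≁ z≁d
  ... | e , there e∈K , z≁e = ¬~⇒≁ λ z~d →
    no-gem (~-sym u~z) (All.lookup Nu (there e∈K)) (~-sym (All.lookup Nv (there e∈K)))
      (¬~⇒≁ z≁e) (≁-sym v≁z) u≁v z~d (All.head Nu) (~-sym (All.lookup (AllPairs.head clique) e∈K)) (All.head Nv)

  -- Otherwise `u` and `v` have a common neighbour `p` in the component. If `z` sees `p`, the path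
  -- `v`, `d`, `u`, `z` with centre `p` is a gem; if not, `w`, `z`, `u`, `p`, `v` is an induced
  -- path.
  mixed⇒adjacent : ∀ {u v w z} → SameComponent u v → CommonNeighbour w → ¬ SameComponent u w →
                   z ≁ d → u ~ z → v ≁ z → w ~ z → u ~ v
  mixed⇒adjacent (_ , _ , inj₁ refl) _ _ _ u~z v≁z _ = ⊥-elim (~⇒¬≁ u~z v≁z)
  mixed⇒adjacent (_ , _ , inj₂ (inj₁ u~v)) _ _ _ _ _ _ = u~v
  mixed⇒adjacent {u} {v} {w} {z} uv@(Nu , Nv , inj₂ (inj₂ (p , Np , u~p , p~v))) Nw ¬uw z≁d u~z v≁z w~z
    = ¬≁⇒~ λ u≁v → case z ~? p of λ where
        (yes z~p) → no-gem (All.head Nv) (~-sym (All.head Nu)) u~z (≁-sym u≁v) v≁z (≁-sym z≁d)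
                      (~-sym p~v) (~-sym (All.head Np)) u~p z~p
        (no z≁p)  → no-P5 w~z (~-sym u~z) u~p p~v
                      (≁-sym (different⇒≁ Nu Nw ¬uw))
                      (≁-sym (different⇒≁ Np Nw (¬uw ∘ same-trans (adjacent⇒same Nu Np u~p))))
                      (≁-sym (different⇒≁ Nv Nw (¬uw ∘ same-trans uv)))
                      (¬~⇒≁ z≁p) (≁-sym v≁z) u≁v

  -- The strict inclusions supply `z₀`, `z₁` separating the `u i` and `t₀`, `t₁` separating the
  -- `w i`. One of these that is mixed on a pair `u i`, `w i` and seen from another component makes
  -- the pair an edge; `one-mixed-edge` forbids two such edges. The other cases end in conflicting
  -- adjacencies among the `z` and `t` vertices.
  no-opposite-chains : (u w : Fin 3 → Fin n) → (∀ i → SameComponent (u i) (w i)) →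
    (∀ i j → i ≢ j → ¬ SameComponent (u i) (u j)) →
    Private (u zero) (u 1F) → Private (u 1F) (u 2F) → ¬ Private (u 1F) (u zero) → ¬ Private (u 2F) (u 1F) →
    Private (w 1F) (w zero) → Private (w 2F) (w 1F) → ¬ Private (w zero) (w 1F) → ¬ Private (w 1F) (w 2F) → ⊥
  no-opposite-chains u w same different
    (z₀ , z₀≁d , u₀~z₀ , u₁≁z₀) (z₁ , z₁≁d , u₁~z₁ , u₂≁z₁) u₁⊆u₀ u₂⊆u₁
    (t₀ , t₀≁d , w₁~t₀ , w₀≁t₀) (t₁ , t₁≁d , w₂~t₁ , w₁≁t₁) w₀⊆w₁ w₁⊆w₂ =
    case w 1F ~? z₀ of λ where
      (yes w₁~z₀) → w₁~z₀⇒⊥ w₁~z₀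
      (no w₁≁z₀) → w₁≁z₀⇒⊥ (¬~⇒≁ w₁≁z₀)
    where
    Nu : ∀ i → CommonNeighbour (u i)
    Nu i = proj₁ (same i)
    Nw : ∀ i → CommonNeighbour (w i)
    Nw i = proj₁ (proj₂ (same i))
    ud : ∀ {i} → u i ~ d
    ud {i} = All.head (Nu i)
    wd : ∀ {i} → w i ~ d
    wd {i} = All.head (Nw i)

    ¬u≈w : ∀ i j → i ≢ j → ¬ SameComponent (u i) (w j)
    ¬u≈w i j i≢j uw = different i j i≢j (same-trans uw (same-sym (same j)))
    ¬w≈u : ∀ i j → i ≢ j → ¬ SameComponent (w i) (u j)
    ¬w≈u i j i≢j wu = different i j i≢j (same-trans (same i) wu)
    ¬w≈w : ∀ i j → i ≢ j → ¬ SameComponent (w i) (w j)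
    ¬w≈w i j i≢j ww = ¬u≈w i j i≢j (same-trans (same i) ww)

    uu : ∀ {i j} → i ≢ j → u i ≁ u j
    uu {i} {j} i≢j = different⇒≁ (Nu i) (Nu j) (different i j i≢j)
    uw : ∀ {i j} → i ≢ j → u i ≁ w j
    uw {i} {j} i≢j = different⇒≁ (Nu i) (Nw j) (¬u≈w i j i≢j)
    wu : ∀ {i j} → i ≢ j → w i ≁ u j
    wu {i} {j} i≢j = different⇒≁ (Nw i) (Nu j) (¬w≈u i j i≢j)
    ww : ∀ {i j} → i ≢ j → w i ≁ w j
    ww {i} {j} i≢j = different⇒≁ (Nw i) (Nw j) (¬w≈w i j i≢j)

    w~u : ∀ i j {z} → i ≢ j → z ≁ d → w i ~ z → u i ≁ z → u j ~ z → w i ~ u i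
    w~u i j i≢j = mixed⇒adjacent (same-sym (same i)) (Nu j) (¬w≈u i j i≢j)
    u~w : ∀ i j {z} → i ≢ j → z ≁ d → u i ~ z → w i ≁ z → w j ~ z → u i ~ w i
    u~w i j i≢j = mixed⇒adjacent (same i) (Nw j) (¬u≈w i j i≢j)

    u₂≁z₀ : u 2F ≁ z₀
    u₂≁z₀ = ¬Private⇒⊇ u₂⊆u₁ z₀≁d u₁≁z₀
    u₀~z₁ : u zero ~ z₁
    u₀~z₁ = ¬Private⇒⊆ u₁⊆u₀ z₁≁d u₁~z₁
    w₂~t₀ : w 2F ~ t₀
    w₂~t₀ = ¬Private⇒⊆ w₁⊆w₂ t₀≁d w₁~t₀
    w₀≁t₁ : w zero ≁ t₁
    w₀≁t₁ = ¬Private⇒⊇ w₀⊆w₁ t₁≁d w₁≁t₁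
    z₁≁z₀ : z₁ ≁ z₀
    z₁≁z₀ = missed-nonadjacent ud ud z₁≁d z₀≁d (uu λ ()) u₂≁z₁ u₂≁z₀ u₁~z₁ u₁≁z₀

    -- `u i` misses both ends of the edge `z₀`, `t₀`, while `w zero` sees only `z₀`.
    z₀~t₀⇒⊥ : ∀ i → zero ≢ i → u i ~ w i → w i ~ z₀ → u i ≁ z₀ → w i ~ t₀ → w zero ~ z₀ → z₀ ~ t₀ → ⊥
    z₀~t₀⇒⊥ i 0≢i uᵢ~wᵢ wᵢ~z₀ uᵢ≁z₀ wᵢ~t₀ w₀~z₀ z₀~t₀ = ~⇒¬≁ z₀~t₀
      (missed-nonadjacent ud wd z₀≁d t₀≁d (uw (0≢i ∘ ≡-sym)) uᵢ≁z₀ uᵢ≁t₀ w₀~z₀ w₀≁t₀)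
      where
      uᵢ≁t₀ : u i ≁ t₀
      uᵢ≁t₀ = ¬~⇒≁ λ uᵢ~t₀ → ~⇒¬≁
        (edge-unmixed ud wd z₀≁d t₀≁d uᵢ~wᵢ z₀~t₀ uᵢ~t₀ wᵢ~t₀ wᵢ~z₀) uᵢ≁z₀

    -- `z₀` is mixed on an edge in component `zero` and on one in component `i`.
    w₀≁z₀⇒⊥ : ∀ i → zero ≢ i → w i ~ u i → w i ~ z₀ → u i ≁ z₀ → w zero ≁ z₀ → ⊥
    w₀≁z₀⇒⊥ i 0≢i wᵢ~uᵢ wᵢ~z₀ uᵢ≁z₀ w₀≁z₀ =
      one-mixed-edge (u~w zero i 0≢i z₀≁d u₀~z₀ w₀≁z₀ wᵢ~z₀) wᵢ~uᵢ
        (uw 0≢i) (uu 0≢i) (ww 0≢i) (wu 0≢i) u₀~z₀ wᵢ~z₀ w₀≁z₀ uᵢ≁z₀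

    w₁~z₀⇒⊥ : w 1F ~ z₀ → ⊥
    w₁~z₀⇒⊥ w₁~z₀ = case w zero ~? z₀ of λ where
        (no w₀≁z₀) → w₀≁z₀⇒⊥ 1F (λ ()) w₁~u₁ w₁~z₀ u₁≁z₀ (¬~⇒≁ w₀≁z₀)
        (yes w₀~z₀) → case w 2F ~? z₀ of λ where
          (yes w₂~z₀) → one-mixed-edge w₁~u₁ (w~u 2F zero (λ ()) z₀≁d w₂~z₀ u₂≁z₀ u₀~z₀)
            (ww λ ()) (wu λ ()) (uw λ ()) (uu λ ()) w₁~z₀ w₂~z₀ u₁≁z₀ u₂≁z₀
          (no w₂≁z₀) → z₀~t₀⇒⊥ 1F (λ ()) (~-sym w₁~u₁) w₁~z₀ u₁≁z₀ w₁~t₀ w₀~z₀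
            (separators-adjacent wd wd z₀≁d t₀≁d (ww λ ()) w₀~z₀ w₂~t₀ w₀≁t₀ (¬~⇒≁ w₂≁z₀))
      where
      w₁~u₁ : w 1F ~ u 1F
      w₁~u₁ = w~u 1F zero (λ ()) z₀≁d w₁~z₀ u₁≁z₀ u₀~z₀

    w₁≁z₀⇒⊥ : w 1F ≁ z₀ → ⊥
    w₁≁z₀⇒⊥ w₁≁z₀ = case w 2F ~? z₁ of λ where
        (yes w₂~z₁) → w₂~z₁⇒⊥ w₂~z₁
        (no w₂≁z₁) → w₂≁z₁⇒⊥ (¬~⇒≁ w₂≁z₁)
      where
      w₂~z₁⇒⊥ : w 2F ~ z₁ → ⊥
      w₂~z₁⇒⊥ w₂~z₁ = case w zero ~? z₀ of λ where
          (no w₀≁z₀) → w₀≁z₀⇒⊥ 2F (λ ()) w₂~u₂ w₂~z₀ u₂≁z₀ (¬~⇒≁ w₀≁z₀)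
          (yes w₀~z₀) → z₀~t₀⇒⊥ 2F (λ ()) (~-sym w₂~u₂) w₂~z₀ u₂≁z₀ w₂~t₀ w₀~z₀
            (separators-adjacent wd wd z₀≁d t₀≁d (ww λ ()) w₀~z₀ w₁~t₀ w₀≁t₀ w₁≁z₀)
        where
        w₂~u₂ : w 2F ~ u 2F
        w₂~u₂ = w~u 2F zero (λ ()) z₁≁d w₂~z₁ u₂≁z₁ u₀~z₁
        w₂~z₀ : w 2F ~ z₀
        w₂~z₀ = ¬≁⇒~ λ w₂≁z₀ → no-P5 (~-sym w₂~u₂) w₂~z₁ (~-sym u₀~z₁) u₀~z₀
          u₂≁z₁ (uu λ ()) u₂≁z₀ (wu λ ()) w₂≁z₀ z₁≁z₀

      w₂≁z₁⇒⊥ : w 2F ≁ z₁ → ⊥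
      w₂≁z₁⇒⊥ w₂≁z₁ = case u 1F ~? t₁ of λ where
          -- Here `t₁` is mixed on the edges of the first two components.
          (yes u₁~t₁) → one-mixed-edge u₀~w₀ (u~w 1F 2F (λ ()) t₁≁d u₁~t₁ w₁≁t₁ w₂~t₁)
            (uu λ ()) (uw λ ()) (wu λ ()) (ww λ ()) u₀~t₁ u₁~t₁ w₀≁t₁ w₁≁t₁
          (no u₁≁t₁) → u₁≁t₁⇒⊥ (¬~⇒≁ u₁≁t₁)
        where
        w₂≁z₀ : w 2F ≁ z₀
        w₂≁z₀ = ¬~⇒≁ λ w₂~z₀ →
          no-zigzag (uu λ ()) (uw λ ()) (uw λ ()) u₁~z₁ u₀~z₁ u₀~z₀ w₂~z₀ z₁≁z₀ u₁≁z₀ w₂≁z₁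
        t₁≁z₀ : t₁ ≁ z₀
        t₁≁z₀ = missed-nonadjacent wd wd t₁≁d z₀≁d (ww λ ()) w₁≁t₁ w₁≁z₀ w₂~t₁ w₂≁z₀
        u₀~t₁ : u zero ~ t₁
        u₀~t₁ = ¬≁⇒~ λ u₀≁t₁ → ~⇒¬≁
          (separators-adjacent ud wd z₀≁d t₁≁d (uw λ ()) u₀~z₀ w₂~t₁ u₀≁t₁ w₂≁z₀) (≁-sym t₁≁z₀)
        u₀~w₀ : u zero ~ w zero
        u₀~w₀ = u~w zero 2F (λ ()) t₁≁d u₀~t₁ w₀≁t₁ w₂~t₁

        u₁≁t₁⇒⊥ : u 1F ≁ t₁ → ⊥
        -- `w zero` misses both ends of the edge `z₁`, `t₁`, while `u 1F` sees only `z₁`.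
        u₁≁t₁⇒⊥ u₁≁t₁ = ~⇒¬≁ z₁~t₁
          (missed-nonadjacent wd ud z₁≁d t₁≁d (wu λ ()) w₀≁z₁ w₀≁t₁ u₁~z₁ u₁≁t₁)
          where
          z₁~t₁ : z₁ ~ t₁
          z₁~t₁ = separators-adjacent ud wd z₁≁d t₁≁d (uw λ ()) u₁~z₁ w₂~t₁ u₁≁t₁ w₂≁z₁
          w₀≁z₁ : w zero ≁ z₁
          w₀≁z₁ = ¬~⇒≁ λ w₀~z₁ → ~⇒¬≁
            (edge-unmixed wd ud t₁≁d z₁≁d (~-sym u₀~w₀) (~-sym z₁~t₁) w₀~z₁ u₀~z₁ u₀~t₁) w₀≁t₁

-- Bounding the order

-- The ways in which mapping one component onto another by labels can fail: a pair of labels loses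
-- an edge inside, or a single label loses a neighbour outside.
Label : ℕ → Set
Label s = (Fin s × Fin s) ⊎ Fin s

labels : ∀ s → List (Label s)
labels s = map inj₁ (cartesianProduct (allFin s) (allFin s)) ++ map inj₂ (allFin s)

∈-labels : ∀ {s} (c : Label s) → c ∈ labels s
∈-labels     (inj₁ (a , b)) = ∈-++⁺ˡ (∈-map⁺ inj₁ (∈-cartesianProduct⁺ (∈-allFin a) (∈-allFin b)))
∈-labels {s} (inj₂ a)       = ∈-++⁺ʳ (map inj₁ (cartesianProduct (allFin s) (allFin s))) (∈-map⁺ inj₂ (∈-allFin a))

-- Counts a vertex, its neighbours and theirs at maximum degree `Δ`; this covers a component, by the
-- distance bound of two.
ballBound : ℕ → ℕ
ballBound Δ = suc (Δ + Δ * Δ)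

-- The summand 3 serves labels that are pairs. The Ramsey number serves two single labels: an
-- antichain of `2 + k` at one of them, or three components forming chains at both.
chainBound : ℕ → ℕ
chainBound k = 3 + ramseyBound (2 + k) (ramseyBound (2 + k) 3)

componentsBound : ℕ → ℕ → ℕ
componentsBound k s = manyRamseyBound (length (labels s)) (manyRamseyBound (length (labels s)) (chainBound k))

-- Bounds the number of common neighbours of a clique on at least 1 + k ∸ j vertices.
commonBound : ℕ → ℕ → ℕ
commonBound k zero    = 0
commonBound k (suc j) = ramseyBound (suc s) (componentsBound k s)
  where s = ballBound (commonBound k j)

-- The factor `1` is the length of the list at the centre; each of three applications of `grow`
-- multiplies by at most `suc Δ`.
orderBound : ℕ → ℕ
orderBound k = 1 * suc Δ * suc Δ * suc Δ
  where Δ = commonBound k k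

All⇒AllPairs : {P : A → Set} {xs : List A} → All P xs → AllPairs (λ x y → P x × P y) xs
All⇒AllPairs []       = []
All⇒AllPairs (p ∷ ps) = All.map (p ,_) ps ∷ All⇒AllPairs ps

module Bounded {n k : ℕ} (G : Graph n) (P5-free : Free P5 G) (gem-free : Free gem G) (crit : Critical k G) where

  open Adjacency G
  open Forbidden G P5-free gem-free
  open CriticalProperties crit

  commonNeighbours : List (Fin n) → List (Fin n)
  commonNeighbours K = filter (λ v → All.all? (v ~?_) K) (allFin n)

  -- `degree≤` is the induction hypothesis for the larger clique `v ∷ d ∷ K`, read as a degree bound
  -- in the graph induced by the common neighbours of `d ∷ K`.
  module CliqueStep (d : Fin n) (K : List (Fin n)) (clique : AllPairs _~_ (d ∷ K)) (Δ : ℕ)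
    (degree≤ : ∀ v → All (v ~_) (d ∷ K) → length (commonNeighbours (v ∷ d ∷ K)) ≤ Δ) where

    open Neighbourhood G P5-free gem-free d
    open Components G P5-free gem-free d K clique

    neighbours : Fin n → List (Fin n)
    neighbours x = commonNeighbours (x ∷ d ∷ K)

    ∈-neighbours⁻ : ∀ {x y} → y ∈ neighbours x → y ~ x × CommonNeighbour y
    ∈-neighbours⁻ {x} y∈ with _ , y~x ∷ Ny ← ∈-filter⁻ (λ v → All.all? (v ~?_) (x ∷ d ∷ K)) {xs = allFin n} y∈ = y~x , Ny

    ∈-neighbours⁺ : ∀ {x y} → y ~ x → CommonNeighbour y → y ∈ neighbours x
    ∈-neighbours⁺ {x} {y} y~x Ny = ∈-filter⁺ (λ v → All.all? (v ~?_) (x ∷ d ∷ K)) (∈-allFin y) (y~x ∷ Ny)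

    ball : Fin n → List (Fin n)
    ball x = x ∷ neighbours x ++ concatMap neighbours (neighbours x)

    length-ball≤ : ∀ {x} → CommonNeighbour x → length (ball x) ≤ ballBound Δ
    length-ball≤ {x} Nx = s≤s (ℕ.≤-trans
      (ℕ.≤-reflexive (length-++ (neighbours x)))
      (ℕ.+-mono-≤ (degree≤ x Nx) (ℕ.≤-trans
        (length-concatMap≤ neighbours Δ (neighbours x)
          (All.tabulate λ y∈ → degree≤ _ (proj₂ (∈-neighbours⁻ y∈))))
        (ℕ.*-monoˡ-≤ Δ (degree≤ x Nx)))))

    ∈-ball⁺ : ∀ {x y} → SameComponent x y → y ∈ ball x
    ∈-ball⁺ (_ , _ , inj₁ refl) = here refl
    ∈-ball⁺ (_ , Ny , inj₂ (inj₁ x~y)) = there (∈-++⁺ˡ (∈-neighbours⁺ (~-sym x~y) Ny))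
    ∈-ball⁺ {x} (_ , Ny , inj₂ (inj₂ (p , Np , x~p , p~y))) = there (∈-++⁺ʳ (neighbours x)
      (∈-concatMap⁺ neighbours (lose (∈-neighbours⁺ (~-sym x~p) Np) (∈-neighbours⁺ (~-sym p~y) Ny))))

    ∈-ball⁻ : ∀ {x y} → CommonNeighbour x → y ∈ ball x → SameComponent x y
    ∈-ball⁻ Nx (here refl) = same-refl Nx
    ∈-ball⁻ {x} Nx (there y∈) with ∈-++⁻ (neighbours x) y∈
    ... | inj₁ y∈nbrs with y~x , Ny ← ∈-neighbours⁻ y∈nbrs = adjacent⇒same Nx Ny (~-sym y~x)
    ... | inj₂ y∈nbrs² with p , p∈ , y∈′ ← find (∈-concatMap⁻ neighbours {xs = neighbours x} y∈nbrs²)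
                       with p~x , Np ← ∈-neighbours⁻ p∈ | y~p , Ny ← ∈-neighbours⁻ y∈′ =
      same-step (adjacent⇒same Nx Np (~-sym p~x)) Ny (~-sym y~p)

    -- copy a v, for a : Fin (ballBound Δ), runs (with repetitions) through the component of v.
    copy : Fin (ballBound Δ) → Fin n → Fin n
    copy a v = nth v (ball v) (toℕ a)

    copy-same : ∀ a {v} → CommonNeighbour v → SameComponent v (copy a v)
    copy-same a Nv = nth-All (same-refl Nv) (All.tabulate (∈-ball⁻ Nv)) (toℕ a)

    copy-onto : ∀ {v x} → SameComponent v x → ∃[ a ] copy a v ≡ x
    copy-onto {v} vx@(Nv , _) with i , i< , eq ← nth-∈ {d = v} (∈-ball⁺ vx) =
      Fin.fromℕ< i<′ , trans (cong (nth v (ball v)) (Fin.toℕ-fromℕ< i<′)) eq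
      where i<′ = ℕ.<-≤-trans i< (length-ball≤ Nv)

    Obstruction : Label (ballBound Δ) → Fin n → Fin n → Set
    Obstruction (inj₁ (a , b)) i j = copy a i ~ copy b i × copy a j ≁ copy b j
    Obstruction (inj₂ a)       i j = Private (copy a i) (copy a j)

    obstruction? : ∀ c → Decidable (Obstruction c)
    obstruction? (inj₁ (a , b)) i j = (copy a i ~? copy b i) ×-dec (copy a j ≁? copy b j)
    obstruction? (inj₂ a)       i j = Private? (copy a i) (copy a j)

    Apart : Fin n → Fin n → Set
    Apart i j = (CommonNeighbour i × CommonNeighbour j) × ¬ SameComponent i j

    apart-sym : ∀ {i j} → Apart i j → Apart j i
    apart-sym ((Ni , Nj) , ¬ij) = (Nj , Ni) , ¬ij ∘ same-sym

    copies-different : ∀ a b {i j} → Apart i j → ¬ SameComponent (copy a i) (copy b j)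
    copies-different a b ((Ni , Nj) , ¬ij) ab =
      ¬ij (same-trans (copy-same a Ni) (same-trans ab (same-sym (copy-same b Nj))))

    copies-≁ : ∀ a b {i j} → Apart i j → copy a i ≁ copy b j
    copies-≁ a b ap@((Ni , Nj) , _) = different⇒≁
      (proj₁ (proj₂ (copy-same a Ni))) (proj₁ (proj₂ (copy-same b Nj))) (copies-different a b ap)

    -- Otherwise copy a i ↦ copy a j retracts G away from the component of i.
    obstructed : ∀ {i j} → Apart i j → Any (λ c → Obstruction c i j) (labels (ballBound Δ))
    obstructed {i} {j} ap@((Ni , Nj) , ¬ij) with Any.any? (λ c → obstruction? c i j) (labels (ballBound Δ))
    ... | yes some = some
    ... | no  none = ⊥-elim (no-retraction f hom i missed)
      where
      unobstructed : ∀ c → ¬ Obstruction c i j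
      unobstructed c o = none (lose (∈-labels c) o)

      -- Labels repeat, so `copy-onto` selects one for each vertex. Taking the decision as an
      -- argument lets the later proofs match on it directly.
      move : ∀ x → Dec (SameComponent i x) → Fin n
      move x (yes ix) = copy (proj₁ (copy-onto ix)) j
      move x (no _)   = x

      f : Fin n → Fin n
      f x = move x (sameComponent? i x)

      -- `v` is not a common neighbour of `d ∷ K`, or it would lie in the component of `i`. If it
      -- missed the new copy, it would therefore lie outside N(`d`) and be an obstruction.
      boundary : ∀ {u v} (iu : SameComponent i u) → ¬ SameComponent i v → u ~ v → copy (proj₁ (copy-onto iu)) j ~ v
      boundary {u} {v} iu ¬iv u~v = ¬≁⇒~ λ a≁v → unobstructed (inj₂ a)
        (v , separator-≁d (proj₁ (proj₂ (copy-same a Ni))) (proj₁ (proj₂ (copy-same a Nj)))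
               (copies-≁ a a ap) a~v a≁v (λ Nv → ¬iv (same-step iu Nv u~v))
           , a~v , a≁v)
        where
        a = proj₁ (copy-onto iu)
        a~v : copy a i ~ v
        a~v = subst (_~ v) (≡-sym (proj₂ (copy-onto iu))) u~v

      move-hom : ∀ {u v} iu iv → u ~ v → move u iu ~ move v iv
      move-hom (yes iu) (yes iv) u~v = ¬≁⇒~ λ a≁b → unobstructed (inj₁ (proj₁ (copy-onto iu) , proj₁ (copy-onto iv)))
        (subst₂ _~_ (≡-sym (proj₂ (copy-onto iu))) (≡-sym (proj₂ (copy-onto iv))) u~v , a≁b)
      move-hom (yes iu) (no ¬iv) u~v = boundary iu ¬iv u~v
      move-hom (no ¬iu) (yes iv) u~v = ~-sym (boundary iv ¬iu (~-sym u~v))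
      move-hom (no _)   (no _)   u~v = u~v

      hom : ∀ {u v} → u ~ v → f u ~ f v
      hom = move-hom (sameComponent? i _) (sameComponent? i _)

      missed : ∀ u → i ≢ f u
      missed u = moved (sameComponent? i u)
        where
        moved : ∀ iu → i ≢ move u iu
        moved (yes iu) eq = ¬ij (subst (λ x → SameComponent x j) (≡-sym eq)
          (same-sym (copy-same (proj₁ (copy-onto iu)) Nj)))
        moved (no ¬iu) refl = ¬iu (same-refl Ni)

    -- One of the `2 + k` vertices plays `u` in `antichain⇒clique`; the others yield a clique of
    -- size `1 + k`.
    no-antichain : ∀ a {vs} → length vs ≡ 2 + k → AllPairs Apart vs →
                   AllPairs (λ i j → Private (copy a i) (copy a j)) vs →
                   AllPairs (λ i j → Private (copy a j) (copy a i)) vs → ⊥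
    no-antichain a {v ∷ vs} len apart forth back
      with zs , len′ , zs-clique ← antichain⇒clique (AllPairs.map⁺ {f = copy a} (AllPairs.zipWith
             (λ { (ap@((Ni , Nj) , _) , ij , ji) →
                  All.head (proj₁ (proj₂ (copy-same a Ni))) , All.head (proj₁ (proj₂ (copy-same a Nj))) ,
                  copies-≁ a a ap , ij , ji })
             (apart , AllPairs.zip (forth , back)))) =
      ℕ.1+n≰n (subst (_≤ k) (trans len′ (trans (length-map (copy a) vs) (ℕ.suc-injective len)))
        (clique-length≤ zs-clique))

    no-opposite-triple : ∀ a b {i₀ i₁ i₂} → AllPairs Apart (i₀ ∷ i₁ ∷ i₂ ∷ []) →
      AllPairs (λ i j → Private (copy a i) (copy a j)) (i₀ ∷ i₁ ∷ i₂ ∷ []) →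
      AllPairs (λ i j → ¬ Private (copy a j) (copy a i)) (i₀ ∷ i₁ ∷ i₂ ∷ []) →
      AllPairs (λ i j → Private (copy b j) (copy b i)) (i₀ ∷ i₁ ∷ i₂ ∷ []) →
      AllPairs (λ i j → ¬ Private (copy b i) (copy b j)) (i₀ ∷ i₁ ∷ i₂ ∷ []) → ⊥
    no-opposite-triple a b {i₀} {i₁} {i₂}
      ((i₀i₁ ∷ i₀i₂ ∷ []) ∷ (i₁i₂ ∷ []) ∷ [] ∷ [])
      ((p₀₁ ∷ _) ∷ (p₁₂ ∷ []) ∷ [] ∷ []) ((p₁₀ ∷ _) ∷ (p₂₁ ∷ []) ∷ [] ∷ [])
      ((q₁₀ ∷ _) ∷ (q₂₁ ∷ []) ∷ [] ∷ []) ((q₀₁ ∷ _) ∷ (q₁₂ ∷ []) ∷ [] ∷ []) =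
      no-opposite-chains (copy a ∘ pick) (copy b ∘ pick)
        (λ x → same-trans (same-sym (copy-same a (N x))) (copy-same b (N x)))
        (λ x y x≢y → copies-different a a (apart x y x≢y))
        p₀₁ p₁₂ p₁₀ p₂₁ q₁₀ q₂₁ q₀₁ q₁₂
      where
      pick : Fin 3 → Fin n
      pick zero = i₀
      pick 1F   = i₁
      pick 2F   = i₂

      N : ∀ x → CommonNeighbour (pick x)
      N zero = proj₁ (proj₁ i₀i₁)
      N 1F   = proj₁ (proj₁ i₁i₂)
      N 2F   = proj₂ (proj₁ i₁i₂)

      apart : ∀ x y → x ≢ y → Apart (pick x) (pick y)
      apart zero 1F   _   = i₀i₁
      apart zero 2F   _   = i₀i₂
      apart 1F   2F   _   = i₁i₂
      apart 1F   zero _   = apart-sym i₀i₁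
      apart 2F   zero _   = apart-sym i₀i₂
      apart 2F   1F   _   = apart-sym i₁i₂
      apart zero zero x≢x = contradiction refl x≢x
      apart 1F   1F   x≢x = contradiction refl x≢x
      apart 2F   2F   x≢x = contradiction refl x≢x

    -- If a label is a pair, the second of three components would both have and lack that adjacency.
    -- For single labels, Ramsey at `a` and then at `b` gives a large antichain or two chains in
    -- opposite directions.
    no-monochromatic : ∀ c c′ {vs} → length vs ≡ chainBound k → AllPairs Apart vs →
                       AllPairs (Obstruction c) vs → AllPairs (flip (Obstruction c′)) vs → ⊥
    no-monochromatic (inj₁ _) _ {_ ∷ _ ∷ _ ∷ _} _ _ (((_ , j≁) ∷ _) ∷ ((j~ , _) ∷ _) ∷ _) _ = ~⇒¬≁ j~ j≁
    no-monochromatic (inj₂ _) (inj₁ _) {_ ∷ _ ∷ _ ∷ _} _ _ _ (((j~ , _) ∷ _) ∷ ((_ , j≁) ∷ _) ∷ _) = ~⇒¬≁ j~ j≁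
    no-monochromatic (inj₂ a) (inj₂ b) {vs} len apart forth back
      with ramsey (λ i j → Private? (copy a j) (copy a i)) (2 + k) (ramseyBound (2 + k) 3) vs
             (ℕ.≤-trans (ℕ.m≤n+m _ 3) (ℕ.≤-reflexive (≡-sym len)))
    ... | inj₁ (ws , ws⊆vs , len′ , a-back) = no-antichain a len′
            (AllPairs-resp-⊆ ws⊆vs apart) (AllPairs-resp-⊆ ws⊆vs forth) a-back
    ... | inj₂ (ws , ws⊆vs , len′ , a-chain)
      with ramsey (λ i j → Private? (copy b i) (copy b j)) (2 + k) 3 ws (ℕ.≤-reflexive (≡-sym len′))
    ...   | inj₁ (xs , xs⊆ws , len″ , b-forth) = no-antichain b len″
              (AllPairs-resp-⊆ (⊆-trans xs⊆ws ws⊆vs) apart) b-forth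
              (AllPairs-resp-⊆ (⊆-trans xs⊆ws ws⊆vs) back)
    ...   | inj₂ (_ ∷ _ ∷ _ ∷ [] , xs⊆ws , refl , b-chain) = no-opposite-triple a b
              (AllPairs-resp-⊆ (⊆-trans xs⊆ws ws⊆vs) apart)
              (AllPairs-resp-⊆ (⊆-trans xs⊆ws ws⊆vs) forth)
              (AllPairs-resp-⊆ xs⊆ws a-chain)
              (AllPairs-resp-⊆ (⊆-trans xs⊆ws ws⊆vs) back) b-chain

    -- `manyRamsey` is applied twice because the label obstructing the map from `i` to `j` may
    -- differ from the one obstructing the reverse map.
    few-components : ∀ {vs} → AllPairs Apart vs → length vs ≢ componentsBound k (ballBound Δ)
    few-components {vs} apart len
      with c , ws , ws⊆vs , len′ , forth ← manyRamsey obstruction? _ _ vs (ℕ.≤-reflexive (≡-sym len))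
             (AllPairs.map obstructed apart)
      with c′ , xs , xs⊆ws , len″ , back ← manyRamsey (flip ∘ obstruction?) _ _ ws (ℕ.≤-reflexive (≡-sym len′))
             (AllPairs.map (obstructed ∘ apart-sym) (AllPairs-resp-⊆ ws⊆vs apart)) =
      no-monochromatic c c′ len″ (AllPairs-resp-⊆ (⊆-trans xs⊆ws ws⊆vs) apart)
        (AllPairs-resp-⊆ xs⊆ws forth) back

    -- Ramsey for `sameComponent?` gives either more vertices in one component than a ball holds, or
    -- too many components.
    few-common-neighbours : length (commonNeighbours (d ∷ K)) <
                            ramseyBound (suc (ballBound Δ)) (componentsBound k (ballBound Δ))
    few-common-neighbours = ℕ.≰⇒> λ many →
      case ramsey sameComponent? _ _ (commonNeighbours (d ∷ K)) many of λ where
        (inj₁ (v ∷ vs , vs⊆ , len , same ∷ _)) → ℕ.1+n≰n (ℕ.≤-trans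
          (subst (_≤ length (ball v)) len (unique-length≤
            (AllPairs-resp-⊆ vs⊆ (Unique.filter⁺ commonNeighbour? (Unique.allFin⁺ n)))
            (here refl ∷ All.map ∈-ball⁺ same)))
          (length-ball≤ (All.head (All-resp-⊆ vs⊆ common))))
        (inj₂ (vs , vs⊆ , len , different)) → few-components
          (AllPairs.zip (All⇒AllPairs (All-resp-⊆ vs⊆ common) , different)) len
      where
      common : All CommonNeighbour (commonNeighbours (d ∷ K))
      common = all-filter commonNeighbour? (allFin n)

  -- Each step enlarges the clique by one and lowers `j` by one; at zero the clique would have more
  -- than `k` vertices.
  common≤ : ∀ j d K → AllPairs _~_ (d ∷ K) → k < suc (length K) + j →
            length (commonNeighbours (d ∷ K)) ≤ commonBound k j
  common≤ zero d K clique large =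
    ⊥-elim (ℕ.<⇒≱ (subst (k <_) (ℕ.+-identityʳ _) large) (clique-length≤ clique))
  common≤ (suc j) d K clique large = ℕ.<⇒≤ (CliqueStep.few-common-neighbours d K clique (commonBound k j)
    λ v Nv → common≤ j v (d ∷ K) (Nv ∷ clique) (subst (k <_) (cong suc (ℕ.+-suc (length K) j)) large))

  -- Covering the graph by a ball of radius three

  closedNeighbours : Fin n → List (Fin n)
  closedNeighbours v = v ∷ commonNeighbours (v ∷ [])

  grow : List (Fin n) → List (Fin n)
  grow = concatMap closedNeighbours

  length-grow≤ : ∀ xs → length (grow xs) ≤ length xs * suc (commonBound k k)
  length-grow≤ xs = length-concatMap≤ closedNeighbours _ xs
    (All.tabulate λ {v} _ → s≤s (common≤ k v [] ([] ∷ []) ℕ.≤-refl))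

  ∈-grow-keep : ∀ xs {x} → x ∈ xs → x ∈ grow xs
  ∈-grow-keep xs x∈ = ∈-concatMap⁺ closedNeighbours {xs = xs} (lose x∈ (here refl))

  ∈-grow-step : ∀ xs {x y} → x ∈ xs → y ~ x → y ∈ grow xs
  ∈-grow-step xs {x} x∈ y~x = ∈-concatMap⁺ closedNeighbours {xs = xs}
    (lose x∈ (there (∈-filter⁺ (λ v → All.all? (v ~?_) (x ∷ [])) (∈-allFin _) (y~x ∷ []))))

  ∈-grow⁻ : ∀ xs {y} → y ∈ grow xs → ∃[ x ] x ∈ xs × (y ≡ x ⊎ y ~ x)
  ∈-grow⁻ xs y∈ with find (∈-concatMap⁻ closedNeighbours {xs = xs} y∈)
  ... | x , x∈ , here eq = x , x∈ , inj₁ eq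
  ... | x , x∈ , there y∈′ with _ , y~x ∷ [] ← ∈-filter⁻ (λ v → All.all? (v ~?_) (x ∷ [])) {xs = allFin n} y∈′ =
    x , x∈ , inj₂ y~x

  module Ball (v : Fin n) where

    ball⁰ ball¹ ball² ball³ : List (Fin n)
    ball⁰ = v ∷ []
    ball¹ = grow ball⁰
    ball² = grow ball¹
    ball³ = grow ball²

    v∈ball⁰ : v ∈ ball⁰
    v∈ball⁰ = here refl

    -- Consider a walk `y`, `x`, `b`, `a`, `v`. Any chord puts `y` within distance three of `v`, and
    -- without chords the walk is an induced path on five vertices.
    ball³-closed : ∀ {x y} → x ∈ ball³ → x ~ y → y ∈ ball³
    ball³-closed {x} {y} x∈ x~y = closed
      where
      from² : x ∈ ball² → y ∈ ball³
      from² x∈² = ∈-grow-step ball² x∈² (~-sym x~y)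

      from¹ : ∀ {b} → b ∈ ball¹ → x ~ b → y ∈ ball³
      from¹ b∈ x~b = from² (∈-grow-step ball¹ b∈ x~b)

      closed : y ∈ ball³
      closed with ∈-grow⁻ ball² x∈
      ... | b , b∈ , inj₁ refl = from² b∈
      ... | b , b∈ , inj₂ x~b with ∈-grow⁻ ball¹ b∈
      ... | a , a∈ , inj₁ refl = from¹ a∈ x~b
      ... | a , a∈ , inj₂ b~a with ∈-grow⁻ ball⁰ a∈
      ... | _ , here refl , inj₁ refl = from¹ (∈-grow-step ball⁰ v∈ball⁰ b~a) x~b
      ... | _ , here refl , inj₂ a~v with y ~? b | y ~? a | y ~? v | x ~? a | x ~? v | b ~? v
      ... | yes y~b | _ | _ | _ | _ | _ = ∈-grow-step ball² b∈ y~b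
      ... | _ | yes y~a | _ | _ | _ | _ = ∈-grow-keep ball² (∈-grow-step ball¹ a∈ y~a)
      ... | _ | _ | yes y~v | _ | _ | _ = ∈-grow-keep ball² (∈-grow-keep ball¹ (∈-grow-step ball⁰ v∈ball⁰ y~v))
      ... | _ | _ | _ | yes x~a | _ | _ = from¹ a∈ x~a
      ... | _ | _ | _ | _ | yes x~v | _ = from² (∈-grow-keep ball¹ (∈-grow-step ball⁰ v∈ball⁰ x~v))
      ... | _ | _ | _ | _ | _ | yes b~v = from¹ (∈-grow-step ball⁰ v∈ball⁰ b~v) x~b
      ... | no y≁b | no y≁a | no y≁v | no x≁a | no x≁v | no b≁v = ⊥-elim
        (no-P5 (~-sym x~y) x~b b~a a~v (¬~⇒≁ y≁b) (¬~⇒≁ y≁a) (¬~⇒≁ y≁v) (¬~⇒≁ x≁a) (¬~⇒≁ x≁v) (¬~⇒≁ b≁v))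

    v∈ball³ : v ∈ ball³
    v∈ball³ = ∈-grow-keep ball² (∈-grow-keep ball¹ (∈-grow-keep ball⁰ v∈ball⁰))

    order≤ball³ : n ≤ length ball³
    order≤ball³ = subst (_≤ length ball³) (length-tabulate id) (unique-length≤ (Unique.allFin⁺ n)
      (All.tabulate λ {u} _ → closed⇒full (λ x → Any.any? (x Fin.≟_) ball³) ball³-closed v∈ball³ u))

    order≤orderBound : n ≤ orderBound k
    order≤orderBound = ℕ.≤-trans order≤ball³
      (ℕ.≤-trans (length-grow≤ ball²) (ℕ.*-monoˡ-≤ Δ
        (ℕ.≤-trans (length-grow≤ ball¹) (ℕ.*-monoˡ-≤ Δ (length-grow≤ ball⁰)))))
      where Δ = suc (commonBound k k)

order≤ : ∀ {n k} {G : Graph n} → VertexCritical k G → Free P5 G → Free gem G → n ≤ orderBound k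
order≤ {zero}  _    _       _        = z≤n
order≤ {suc n} {G = G} crit P5-free gem-free = Bounded.Ball.order≤orderBound G P5-free gem-free (critical crit) zero

-- Enumerating graphs

vectors : List A → ∀ n → List (Vec A n)
vectors xs zero    = [] ∷ []
vectors xs (suc n) = cartesianProductWith _∷_ xs (vectors xs n)

∈-vectors : {xs : List A} → (∀ x → x ∈ xs) → ∀ {n} (v : Vec A n) → v ∈ vectors xs n
∈-vectors full []      = here refl
∈-vectors full (x ∷ v) = ∈-cartesianProductWith⁺ _∷_ (full x) (∈-vectors full v)

Matrix : ℕ → Set
Matrix n = Vec (Vec Bool n) n

entry : ∀ {n} → Matrix n → Fin n → Fin n → Bool
entry M u v = Vec.lookup (Vec.lookup M u) v

matrices : ∀ n → List (Matrix n)
matrices n = vectors (vectors (true ∷ false ∷ []) n) n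

∈-matrices : ∀ {n} (M : Matrix n) → M ∈ matrices n
∈-matrices = ∈-vectors (∈-vectors λ { true → here refl ; false → there (here refl) })

-- Every Boolean matrix is turned into a graph, so all matrices can be enumerated without filtering;
-- adjacency matrices keep their entries.
symmetrised : ∀ {n} → Matrix n → Graph n
symmetrised M = record
  { adj    = λ u v → not ⌊ u Fin.≟ v ⌋ ∧ (entry M u v ∨ entry M v u)
  ; sym    = λ u v → cong₂ _∧_ (cong not (≟-comm u v)) (Bool.∨-comm (entry M u v) (entry M v u))
  ; irrefl = λ v → cong (λ b → not b ∧ (entry M v v ∨ entry M v v)) (≟-refl v)
  }
  where
  ≟-refl : ∀ v → ⌊ v Fin.≟ v ⌋ ≡ true
  ≟-refl v with v Fin.≟ v
  ... | yes _  = refl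
  ... | no v≢v = contradiction refl v≢v
  ≟-comm : ∀ u v → ⌊ u Fin.≟ v ⌋ ≡ ⌊ v Fin.≟ u ⌋
  ≟-comm u v with u Fin.≟ v | v Fin.≟ u
  ... | yes _   | yes _   = refl
  ... | no _    | no _    = refl
  ... | yes u≡v | no v≢u  = contradiction (≡-sym u≡v) v≢u
  ... | no u≢v  | yes v≡u = contradiction (≡-sym v≡u) u≢v

adjacencyMatrix : ∀ {n} → Graph n → Matrix n
adjacencyMatrix G = Vec.tabulate λ u → Vec.tabulate (adj G u)

entry-adjacencyMatrix : ∀ {n} (G : Graph n) u v → entry (adjacencyMatrix G) u v ≡ adj G u v
entry-adjacencyMatrix G u v = trans
  (cong (λ row → Vec.lookup row v) (Vec.lookup∘tabulate (λ u → Vec.tabulate (adj G u)) u))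
  (Vec.lookup∘tabulate (adj G u) v)

symmetrised-adj : ∀ {n} (G : Graph n) u v → adj (symmetrised (adjacencyMatrix G)) u v ≡ adj G u v
symmetrised-adj G u v rewrite entry-adjacencyMatrix G u v | entry-adjacencyMatrix G v u | sym G v u
  with u Fin.≟ v
... | yes refl = ≡-sym (irrefl G u)
... | no _     = Bool.∨-idem (adj G u v)

graphsOfOrder : ∀ n → List AnyGraph
graphsOfOrder n = map (λ M → ⟨ n , symmetrised M ⟩) (matrices n)

bounded⇒finitelyMany : (P : ∀ {n} → Graph n → Set) (m : ℕ) → (∀ {n} (G : Graph n) → P G → n ≤ m) →
                       FinitelyManyUpToIso P
bounded⇒finitelyMany P m bound = concatMap graphsOfOrder (upTo (suc m)) , λ {n} G PG →
  ⟨ n , symmetrised (adjacencyMatrix G) ⟩ ,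
  ∈-concatMap⁺ graphsOfOrder (lose (∈-upTo⁺ (s≤s (bound G PG)))
    (∈-map⁺ (λ M → ⟨ n , symmetrised M ⟩) (∈-matrices (adjacencyMatrix G)))) ,
  -- The listed graph agrees with `G` pointwise, so the identity is an isomorphism.
  record { to = id ; from = id ; from∘to = λ _ → refl ; to∘from = λ _ → refl ; pres = symmetrised-adj G }

theorem3p1 : (k : ℕ) → k ≥ 1 →
    FinitelyManyUpToIso (λ G → VertexCritical k G × Free P5 G × Free gem G)
theorem3p1 k _ = bounded⇒finitelyMany _ (orderBound k)
  λ _ (crit , P5-free , gem-free) → order≤ crit P5-free gem-free
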